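{- Let $E=\{e_1,\dots,e_n\}$ be a finite set and let $\mathcal{R}$ be the quantitative theory of reading computations of type $E$. The monads $T_{\mathcal{R}}$ and $(-)^{\underline{E}}$ on $\mathbf{Met}$ are isomorphic.
   Context: An extended metric space is a set $X$ with $d_X:X\times X\to[0,\infty]$ satisfying $d_X(x,y)=0$ iff $x=y$, symmetry and the triangle inequality. $\mathbf{Met}$ is the category of extended metric spaces and non-expansive maps. Quantitative theories. A signature $\Sigma$ is a set of function symbols $f:n$ of finite arity $n\in\mathbb{N}$. Fix a countably infinite set of variables $V$; terms are $\Sigma$-terms over $V$. A quantitative equation is an expression $t=_\varepsilon s$ with $t,s$ terms and $\varepsilon\in\mathbb{Q}_{\ge0}$. A conditional quantitative equation is $\Gamma\vdash t=_\varepsilon s$ with $\Gamma$ a finite set of quantitative equations. A quantitative equational theory of type $\Sigma$ is a set $\mathcal{U}$ of conditional quantitative equations containing (for all variables and rationals $\varepsilon,\varepsilon'\ge 0$) $\vdash x=_0x$; $\{x=_\varepsilon y\}\vdash y=_\varepsilon x$; $\{x=_\varepsilon z,z=_{\varepsilon'}y\}\vdash x=_{\varepsilon+\varepsilon'}y$; $\{x=_\varepsilon y\}\vdash x=_{\varepsilon+\varepsilon'}y$ for $\varepsilon'>0$; $\{x_i=_\varepsilon y_i\mid i=1,\dots,n\}\vdash f(x_1,\dots,x_n)=_\varepsilon f(y_1,\dots,y_n)$ for $f:n\in\Sigma$; and closed under: continuity (if $\Gamma\vdash t=_{\varepsilon'}s\in\mathcal{U}$ for all $\varepsilon'>\varepsilon$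 then $\Gamma\vdash t=_\varepsilon s\in\mathcal{U}$), substitution of terms for variables, assumption ($\Gamma\vdash\phi\in\mathcal{U}$ whenever $\phi\in\Gamma$), and cut (if $\Gamma\vdash\phi\in\mathcal{U}$ for all $\phi\in\Theta$ and $\Theta\vdash\psi\in\mathcal{U}$ then $\Gamma\vdash\psi\in\mathcal{U}$). A set $A$ of conditional quantitative equations axiomatizes $\mathcal{U}$ if $\mathcal{U}$ is the smallest theory containing $A$. Models. A quantitative $\Sigma$-algebra is an extended metric space $A$ with, for each $f:n\in\Sigma$, a map $f^A:A^n\to A$ that is non-expansive for the max metric on $A^n$. It satisfies $\Gamma\vdash t=_\varepsilon s$ if for every assignment $\iota:V\to A$ (extended homomorphically to terms), $d_A(\iota(t'),\iota(s'))\le\varepsilon'$ for all $t'=_{\varepsilon'}s'\in\Gamma$ implies $d_A(\iota(t),\iota(s))\le\varepsilon$. $\mathbb{K}(\Sigma,\mathcal{U})$ is the category of quantitative $\Sigma$-algebras satisfying all members of $\mathcal{U}$, with non-expansive $\Sigma$-homomorphisms. The forgetful functor $\mathbb{K}(\Sigma,\mathcal{U})\to\mathbf{Met}$ has a left adjoint (known result); $T_{\mathcal{U}}$ denotes the induced monad on $\mathbf{Met}$. Reader theory. $\mathcal{R}$ has signature $\{\mathsf{r}:n\}$, $n=|E|$, and is axiomatized by $\vdash x=_0\mathsf{r}(x,\dots,x)$ and $\vdash\mathsf{r}(x_{1,1},\dots,x_{n,n})=_0\mathsf{r}(\mathsf{r}(x_{1,1},\dots,x_{1,n}),\dots,\mathsf{r}(x_{n,1},\dots,x_{n,n}))$.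 Reader monad. $\underline{E}$ is $E$ with the discrete metric (distance $\infty$ between distinct points). $X^{\underline{E}}$ is the set of all maps $E\to X$ with metric $\sup_{e\in E}d_X(f(e),g(e))$; on morphisms $f^{\underline{E}}(g)=f\circ g$. The unit is $\kappa_X(x)(e)=x$ and the multiplication is $\zeta_X(g)(e)=g(e)(e)$ for $g\in(X^{\underline{E}})^{\underline{E}}$. -}

module Defs where

open import Level using (Level; _⊔_; 0ℓ) renaming (suc to lsuc)
open import Data.Nat.Base using (ℕ)
open import Data.Fin.Base using (Fin; zero; suc; toℕ; combine)
open import Data.Rational.Base as ℚ using (ℚ; 0ℚ)
import Data.Rational.Properties as ℚₚ
open import Data.List.Base as List using (List; []; _∷_)
open import Data.List.Membership.Propositional using (_∈_)
open import Data.Product.Base using (∃; _×_; _,_; proj₁; proj₂)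
open import Data.Unit.Base using (⊤; tt)
import Data.Unit.Polymorphic.Base as ⊤ₚ
open import Data.Vec.Base as Vec using (Vec; []; _∷_; lookup; tabulate)
open import Data.Vec.Properties using (lookup∘tabulate; tabulate∘lookup; tabulate-cong)
open import Function.Base using (_∘_; id)
open import Function.Bundles using (_⇔_; mk⇔; Equivalence)
open import Relation.Binary.Bundles using (Setoid)
open import Relation.Binary.Core using (Rel)
open import Relation.Binary.Structures using (IsEquivalence)
open import Relation.Binary.PropositionalEquality as ≡ using (_≡_)
open import Relation.Unary using (Pred; _⊆_) renaming (_∈_ to _∈ᵖ_)

record Category (o ℓ e : Level) : Set (lsuc (o ⊔ ℓ ⊔ e)) where
  infixr 9 _∙_
  infix  4 _≈_
  field
    Obj       : Set o
    Hom       : Obj → Obj → Set ℓ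
    _≈_       : ∀ {A B} → Rel (Hom A B) e
    idn       : ∀ {A} → Hom A A
    _∙_       : ∀ {A B C} → Hom B C → Hom A B → Hom A C
    equiv     : ∀ {A B} → IsEquivalence (_≈_ {A} {B})
    ∙-resp-≈  : ∀ {A B C} {f g : Hom B C} {h k : Hom A B} →
                f ≈ g → h ≈ k → f ∙ h ≈ g ∙ k
    identityˡ : ∀ {A B} {f : Hom A B} → idn ∙ f ≈ f
    identityʳ : ∀ {A B} {f : Hom A B} → f ∙ idn ≈ f
    assoc     : ∀ {A B C D} {f : Hom C D} {g : Hom B C} {h : Hom A B} →
                (f ∙ g) ∙ h ≈ f ∙ (g ∙ h)

  module Eq {A B} = IsEquivalence (equiv {A} {B})

record Functor {o ℓ e o′ ℓ′ e′} (C : Category o ℓ e) (D : Category o′ ℓ′ e′) :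
               Set (o ⊔ ℓ ⊔ e ⊔ o′ ⊔ ℓ′ ⊔ e′) where
  private
    module C = Category C
    module D = Category D
  field
    F₀           : C.Obj → D.Obj
    F₁           : ∀ {A B} → C.Hom A B → D.Hom (F₀ A) (F₀ B)
    F-resp-≈     : ∀ {A B} {f g : C.Hom A B} → f C.≈ g → F₁ f D.≈ F₁ g
    identity     : ∀ {A} → F₁ (C.idn {A}) D.≈ D.idn
    homomorphism : ∀ {A B X} {f : C.Hom B X} {g : C.Hom A B} →
                   F₁ (f C.∙ g) D.≈ F₁ f D.∙ F₁ g

idF : ∀ {o ℓ e} {C : Category o ℓ e} → Functor C C
idF {C = C} = record
  { F₀ = id ; F₁ = id ; F-resp-≈ = id
  ; identity = Category.Eq.refl C ; homomorphism = Category.Eq.refl C }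

infixr 9 _∘F_
_∘F_ : ∀ {o ℓ e o′ ℓ′ e′ o″ ℓ″ e″} {C : Category o ℓ e} {D : Category o′ ℓ′ e′}
       {B : Category o″ ℓ″ e″} → Functor D B → Functor C D → Functor C B
_∘F_ {B = B} G F = record
  { F₀           = G.F₀ ∘ F.F₀
  ; F₁           = G.F₁ ∘ F.F₁
  ; F-resp-≈     = G.F-resp-≈ ∘ F.F-resp-≈
  ; identity     = Category.Eq.trans B (G.F-resp-≈ F.identity) G.identity
  ; homomorphism = Category.Eq.trans B (G.F-resp-≈ F.homomorphism) G.homomorphism
  }
  where
    module F = Functor F
    module G = Functor G

record NatTrans {o ℓ e o′ ℓ′ e′} {C : Category o ℓ e} {D : Category o′ ℓ′ e′}
                (F G : Functor C D) : Set (o ⊔ ℓ ⊔ ℓ′ ⊔ e′) where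
  private
    module C = Category C
    module D = Category D
    module F = Functor F
    module G = Functor G
  field
    component : ∀ A → D.Hom (F.F₀ A) (G.F₀ A)
    commute   : ∀ {A B} (f : C.Hom A B) →
                component B D.∙ F.F₁ f D.≈ G.F₁ f D.∙ component A

record Adjunction {o ℓ e o′ ℓ′ e′} {C : Category o ℓ e} {D : Category o′ ℓ′ e′}
                  (L : Functor C D) (R : Functor D C) :
                  Set (o ⊔ ℓ ⊔ e ⊔ o′ ⊔ ℓ′ ⊔ e′) where
  private
    module C = Category C
    module D = Category D
    module L = Functor L
    module R = Functor R
  field
    unit   : NatTrans idF (R ∘F L)
    counit : NatTrans (L ∘F R) idF
  module unit   = NatTrans unit
  module counit = NatTrans counit
  field
    zig : ∀ {A} → counit.component (L.F₀ A) D.∙ L.F₁ (unit.component A) D.≈ D.idn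
    zag : ∀ {B} → R.F₁ (counit.component B) C.∙ unit.component (R.F₀ B) C.≈ C.idn

record Monad {o ℓ e} (C : Category o ℓ e) : Set (o ⊔ ℓ ⊔ e) where
  private module C = Category C
  field
    F : Functor C C
    η : NatTrans idF F
    μ : NatTrans (F ∘F F) F
  module F = Functor F
  module η = NatTrans η
  module μ = NatTrans μ
  field
    assoc     : ∀ {A} → μ.component A C.∙ F.F₁ (μ.component A)
                        C.≈ μ.component A C.∙ μ.component (F.F₀ A)
    identityˡ : ∀ {A} → μ.component A C.∙ F.F₁ (η.component A) C.≈ C.idn
    identityʳ : ∀ {A} → μ.component A C.∙ η.component (F.F₀ A) C.≈ C.idn

record MonadIso {o ℓ e} {C : Category o ℓ e} (S T : Monad C) : Set (o ⊔ ℓ ⊔ e) where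
  private
    module C = Category C
    module S = Monad S
    module T = Monad T
  field
    to   : NatTrans S.F T.F
    from : NatTrans T.F S.F
  module to   = NatTrans to
  module from = NatTrans from
  field
    to∘from : ∀ A → to.component A C.∙ from.component A C.≈ C.idn
    from∘to : ∀ A → from.component A C.∙ to.component A C.≈ C.idn
    unit-comm : ∀ A → to.component A C.∙ S.η.component A C.≈ T.η.component A
    mult-comm : ∀ A → to.component A C.∙ S.μ.component A
                      C.≈ T.μ.component A C.∙ (T.F.F₁ (to.component A)
                                               C.∙ to.component (S.F.F₀ A))

module _ {o ℓ e o′ ℓ′ e′} {C : Category o ℓ e} {D : Category o′ ℓ′ e′}
         {L : Functor C D} {R : Functor D C} (adj : Adjunction L R) where
  private
    module C = Category C
    module D = Category D
    module L = Functor L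
    module R = Functor R
    module adj = Adjunction adj
    ε = adj.counit.component

  inducedMonad : Monad C
  inducedMonad = record
    { F = R ∘F L
    ; η = adj.unit
    ; μ = record
      { component = λ A → R.F₁ (ε (L.F₀ A))
      ; commute   = λ f → square (adj.counit.commute (L.F₁ f))
      }
    ; assoc     = square (adj.counit.commute (ε _))
    ; identityˡ = C.Eq.trans (C.Eq.sym R.homomorphism)
                    (C.Eq.trans (R.F-resp-≈ adj.zig) R.identity)
    ; identityʳ = adj.zag
    }
    where
      square : ∀ {A B X Y} {f : D.Hom B Y} {g : D.Hom A B} {h : D.Hom X Y} {k : D.Hom A X} →
               f D.∙ g D.≈ h D.∙ k → R.F₁ f C.∙ R.F₁ g C.≈ R.F₁ h C.∙ R.F₁ k
      square p = C.Eq.trans (C.Eq.sym R.homomorphism)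
                   (C.Eq.trans (R.F-resp-≈ p) R.homomorphism)

record ℚ≥0 : Set where
  constructor mkℚ≥0
  field
    value        : ℚ
    .⦃ nonNeg ⦄  : ℚ.NonNegative value
open ℚ≥0 public using (value)

infixl 6 _+_
infix  4 _≤_ _<_

0₊ : ℚ≥0
0₊ = mkℚ≥0 0ℚ

_+_ : ℚ≥0 → ℚ≥0 → ℚ≥0
mkℚ≥0 p + mkℚ≥0 q = mkℚ≥0 (p ℚ.+ q) ⦃ ℚₚ.nonNeg+nonNeg⇒nonNeg p q ⦄

_≤_ _<_ : ℚ≥0 → ℚ≥0 → Set
p ≤ q = value p ℚ.≤ value q
p < q = value p ℚ.< value q

0≤ : ∀ q → 0₊ ≤ q
0≤ (mkℚ≥0 q) = ℚₚ.nonNegative⁻¹ q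

<-dense : ∀ {p r} → p < r → ∃ λ q → p < q × q < r
<-dense {p} {r} p<r with ℚₚ.<-dense p<r
... | m , p<m , m<r =
  mkℚ≥0 m ⦃ ℚ.nonNegative (ℚₚ.≤-trans (0≤ p) (ℚₚ.<⇒≤ p<m)) ⦄ , p<m , m<r

-- The extended half-line [0,∞].  A point r is given by the set
-- { ε ∈ ℚ≥0 ∣ r ≤ ε } of its rational upper bounds; classically
-- r ↦ { ε ∣ r ≤ ε } is a bijection from the extended non-negative reals
-- onto the sets described by the following record (∅ corresponds to ∞).

record [0,∞] (ℓ : Level) : Set (lsuc ℓ) where
  infix 4 _≤ℚ_
  field
    _≤ℚ_   : ℚ≥0 → Set ℓ
    upward : ∀ {ε ε′} → ε ≤ ε′ → _≤ℚ_ ε → _≤ℚ_ ε′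
    closed : ∀ {ε} → (∀ {ε′} → ε < ε′ → _≤ℚ_ ε′) → _≤ℚ_ ε
open [0,∞] public

infix  4 _≤∞_ _≃∞_
infixl 6 _+∞_

-- r ≤ s iff every rational upper bound of s is one of r.
_≤∞_ _≃∞_ : ∀ {ℓ} → Rel ([0,∞] ℓ) ℓ
r ≤∞ s = ∀ {ε} → s ≤ℚ ε → r ≤ℚ ε
r ≃∞ s = r ≤∞ s × s ≤∞ r

0∞ : ∀ {ℓ} → [0,∞] ℓ
0∞ = record { _≤ℚ_ = λ _ → ⊤ₚ.⊤ }

≃0∞ : ∀ {ℓ} (r : [0,∞] ℓ) → r ≤ℚ 0₊ → r ≃∞ 0∞
≃0∞ r p = (λ {ε} _ → upward r {0₊} {ε} (0≤ ε) p) , λ {ε} _ → ⊤ₚ.tt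

-- The sums of upper bounds of r and s need not form a closed set (take
-- r = √2, s = 2 − √2), hence the quantification over ε′.
_+∞_ : ∀ {ℓ} → [0,∞] ℓ → [0,∞] ℓ → [0,∞] ℓ
r +∞ s = record
  { _≤ℚ_   = λ ε → ∀ {ε′} → ε < ε′ →
             ∃ λ δ₁ → ∃ λ δ₂ → r ≤ℚ δ₁ × s ≤ℚ δ₂ × δ₁ + δ₂ ≤ ε′
  ; upward = λ ε≤ε′ p {ε″} ε′<ε″ → p {ε″} (ℚₚ.≤-<-trans ε≤ε′ ε′<ε″)
  ; closed = λ {ε} p {ε″} ε<ε″ → let ε′ , ε<ε′ , ε′<ε″ = <-dense {ε} {ε″} ε<ε″
                                 in p {ε′} ε<ε′ {ε″} ε′<ε″
  }

-- The supremum (the maximum when I is finite; 0 when I is empty): ε bounds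
-- it iff ε bounds every r i.
⨆ : ∀ {ℓ} {I : Set} → (I → [0,∞] ℓ) → [0,∞] ℓ
⨆ r = record
  { _≤ℚ_   = λ ε → ∀ i → r i ≤ℚ ε
  ; upward = λ ε≤ε′ p i → upward (r i) ε≤ε′ (p i)
  ; closed = λ p i → closed (r i) λ ε<ε′ → p ε<ε′ i
  }

-- Extended metric spaces.  Quotients are represented by setoids, so the
-- equality of points is the setoid equality _≈_.

record ExtMetric (ℓ : Level) : Set (lsuc ℓ) where
  field
    setoid : Setoid ℓ ℓ
  open Setoid setoid public
  field
    d      : Carrier → Carrier → [0,∞] ℓ
    d-zero : ∀ x y → (d x y ≃∞ 0∞) ⇔ x ≈ y
    d-sym  : ∀ x y → d x y ≃∞ d y x
    d-tri  : ∀ x y z → d x z ≤∞ d x y +∞ d y z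

  near : ∀ {x y} → x ≈ y → ∀ ε → d x y ≤ℚ ε
  near x≈y ε = proj₁ (Equivalence.from (d-zero _ _) x≈y) {ε} ⊤ₚ.tt

  near⁻¹ : ∀ {x y} → d x y ≤ℚ 0₊ → x ≈ y
  near⁻¹ {x} {y} p = Equivalence.to (d-zero _ _) (≃0∞ (d x y) p)

  d-tri-≤ : ∀ {x y z ε δ} → d x y ≤ℚ ε → d y z ≤ℚ δ → d x z ≤ℚ (ε + δ)
  d-tri-≤ {x} {y} {z} {ε} {δ} p q =
    d-tri x y z λ ε+δ<ε′ → ε , δ , p , q , ℚₚ.<⇒≤ ε+δ<ε′

  d-resp-≈ : ∀ {x x′ y y′ ε} → x ≈ x′ → y ≈ y′ → d x y ≤ℚ ε → d x′ y′ ≤ℚ ε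
  d-resp-≈ {x} {x′} {y} {y′} {ε} x≈x′ y≈y′ p =
    upward (d x′ y′)
      (ℚₚ.≤-reflexive (≡.trans (ℚₚ.+-identityʳ _) (ℚₚ.+-identityˡ _)))
      (d-tri-≤ (d-tri-≤ (near (sym x≈x′) 0₊) p) (near y≈y′ 0₊))

∣_∣ : ∀ {ℓ} → ExtMetric ℓ → Set ℓ
∣_∣ = ExtMetric.Carrier

record NonExpansive {ℓ} (X Y : ExtMetric ℓ) : Set ℓ where
  private
    module X = ExtMetric X
    module Y = ExtMetric Y
  infixl 20 _$_
  field
    _$_     : ∣ X ∣ → ∣ Y ∣
    non-exp : ∀ x y → Y.d (_$_ x) (_$_ y) ≤∞ X.d x y

  $-cong : ∀ {x y} → x X.≈ y → _$_ x Y.≈ _$_ y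
  $-cong x≈y = Y.near⁻¹ (non-exp _ _ (X.near x≈y 0₊))
open NonExpansive public

Met : ∀ ℓ → Category (lsuc ℓ) ℓ ℓ
Met ℓ = record
  { Obj       = ExtMetric ℓ
  ; Hom       = NonExpansive
  ; _≈_       = λ {X} {Y} f g → ∀ x → let open ExtMetric Y in f $ x ≈ g $ x
  ; idn       = record { _$_ = id ; non-exp = λ _ _ p → p }
  ; _∙_       = λ g f → record
    { _$_     = λ x → g $ (f $ x)
    ; non-exp = λ x y p → non-exp g _ _ (non-exp f x y p) }
  ; equiv     = λ {X} {Y} → let open ExtMetric Y in record
    { refl = λ _ → refl ; sym = λ p x → sym (p x) ; trans = λ p q x → trans (p x) (q x) }
  ; ∙-resp-≈  = λ {X} {Y} {Z} {f} {g} {h} {k} f≈g h≈k x →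
                ExtMetric.trans Z (f≈g (h $ x)) ($-cong g (h≈k x))
  ; identityˡ = λ {_} {Y} _ → ExtMetric.refl Y
  ; identityʳ = λ {_} {Y} _ → ExtMetric.refl Y
  ; assoc     = λ {_} {_} {_} {Z} _ → ExtMetric.refl Z
  }

-- All maps I → X with the supremum metric.  For I = Fin n this is Xⁿ with
-- the max metric; for I = E it is X^E̲, every map out of a discrete space
-- being non-expansive.
_^_ : ∀ {ℓ} → ExtMetric ℓ → Set → ExtMetric ℓ
X ^ I = record
  { setoid = record
    { Carrier       = I → Carrier
    ; _≈_           = λ f g → ∀ i → f i ≈ g i
    ; isEquivalence = record
      { refl  = λ _ → refl
      ; sym   = λ p i → sym (p i)
      ; trans = λ p q i → trans (p i) (q i) }
    }
  ; d      = λ f g → ⨆ λ i → d (f i) (g i)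
  ; d-zero = λ f g → mk⇔ (λ p i → near⁻¹ (proj₁ p {0₊} ⊤ₚ.tt i))
                         (λ p → ≃0∞ (⨆ λ i → d (f i) (g i)) λ i → near (p i) 0₊)
  ; d-sym  = λ f g → (λ p i → proj₁ (d-sym (f i) (g i)) (p i))
                   , (λ p i → proj₂ (d-sym (f i) (g i)) (p i))
  ; d-tri  = λ f g h p i → d-tri (f i) (g i) (h i) λ {ε′} ε<ε′ →
             let δ₁ , δ₂ , p₁ , p₂ , le = p {ε′} ε<ε′ in δ₁ , δ₂ , p₁ i , p₂ i , le
  }
  where open ExtMetric X

record Signature : Set₁ where
  field
    Op    : Set
    arity : Op → ℕ
open Signature public

data Term {ℓ} (S : Signature) (X : Set ℓ) : Set ℓ where
  var : X → Term S X
  op  : (f : Op S) → Vec (Term S X) (arity S f) → Term S X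

infix 8 _[_] _[_]*

mutual
  _[_] : ∀ {S ℓ ℓ′} {X : Set ℓ} {Y : Set ℓ′} → Term S X → (X → Term S Y) → Term S Y
  var x   [ σ ] = σ x
  op f ts [ σ ] = op f (ts [ σ ]*)

  _[_]* : ∀ {S ℓ ℓ′ n} {X : Set ℓ} {Y : Set ℓ′} →
          Vec (Term S X) n → (X → Term S Y) → Vec (Term S Y) n
  []       [ σ ]* = []
  (t ∷ ts) [ σ ]* = t [ σ ] ∷ ts [ σ ]*

V : Set
V = ℕ

infix 5 _=[_]_
infix 4 _⊢_

record QEq (S : Signature) : Set where
  constructor _=[_]_
  field
    lhs : Term S V
    ε   : ℚ≥0
    rhs : Term S V

-- The finite set of premises is given by an enumeration; theories see only
-- its elements, by assumption and cut.
record CondQEq (S : Signature) : Set where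
  constructor _⊢_
  field
    premises   : List (QEq S)
    conclusion : QEq S

substQEq : ∀ {S} → (V → Term S V) → QEq S → QEq S
substQEq σ (t =[ ε ] s) = t [ σ ] =[ ε ] s [ σ ]

module _ {S : Signature} where

  _=[_]ᵥ_ : V → ℚ≥0 → V → QEq S
  x =[ ε ]ᵥ y = var x =[ ε ] var y

  record IsTheory {ℓ} (𝒰 : Pred (CondQEq S) ℓ) : Set ℓ where
    field
      refl   : ∀ x → ([] ⊢ x =[ 0₊ ]ᵥ x) ∈ᵖ 𝒰
      symm   : ∀ x y ε → (x =[ ε ]ᵥ y ∷ [] ⊢ y =[ ε ]ᵥ x) ∈ᵖ 𝒰
      triang : ∀ x y z ε ε′ →
               (x =[ ε ]ᵥ z ∷ z =[ ε′ ]ᵥ y ∷ [] ⊢ x =[ ε + ε′ ]ᵥ y) ∈ᵖ 𝒰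
      max    : ∀ x y ε ε′ → 0₊ < ε′ →
               (x =[ ε ]ᵥ y ∷ [] ⊢ x =[ ε + ε′ ]ᵥ y) ∈ᵖ 𝒰
      nexp   : ∀ f (x y : Fin (arity S f) → V) ε →
               (List.tabulate (λ i → x i =[ ε ]ᵥ y i)
                ⊢ op f (tabulate (var ∘ x)) =[ ε ] op f (tabulate (var ∘ y))) ∈ᵖ 𝒰
      cont   : ∀ {Γ t s ε} → (∀ ε′ → ε < ε′ → (Γ ⊢ t =[ ε′ ] s) ∈ᵖ 𝒰) →
               (Γ ⊢ t =[ ε ] s) ∈ᵖ 𝒰
      subst  : ∀ {Γ φ} (σ : V → Term S V) → (Γ ⊢ φ) ∈ᵖ 𝒰 →
               (List.map (substQEq σ) Γ ⊢ substQEq σ φ) ∈ᵖ 𝒰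
      assum  : ∀ {Γ φ} → φ ∈ Γ → (Γ ⊢ φ) ∈ᵖ 𝒰
      cut    : ∀ {Γ Θ ψ} → (∀ {φ} → φ ∈ Θ → (Γ ⊢ φ) ∈ᵖ 𝒰) → (Θ ⊢ ψ) ∈ᵖ 𝒰 →
               (Γ ⊢ ψ) ∈ᵖ 𝒰

  -- The least theory containing A; see ⟨⟩-isTheory and ⟨⟩-least.
  data ⟨_⟩ (A : Pred (CondQEq S) 0ℓ) : Pred (CondQEq S) 0ℓ where
    axiom   : ∀ {φ} → φ ∈ᵖ A → φ ∈ᵖ ⟨ A ⟩
    ⊢refl   : ∀ x → ([] ⊢ x =[ 0₊ ]ᵥ x) ∈ᵖ ⟨ A ⟩
    ⊢symm   : ∀ x y ε → (x =[ ε ]ᵥ y ∷ [] ⊢ y =[ ε ]ᵥ x) ∈ᵖ ⟨ A ⟩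
    ⊢triang : ∀ x y z ε ε′ →
              (x =[ ε ]ᵥ z ∷ z =[ ε′ ]ᵥ y ∷ [] ⊢ x =[ ε + ε′ ]ᵥ y) ∈ᵖ ⟨ A ⟩
    ⊢max    : ∀ x y ε ε′ → 0₊ < ε′ →
              (x =[ ε ]ᵥ y ∷ [] ⊢ x =[ ε + ε′ ]ᵥ y) ∈ᵖ ⟨ A ⟩
    ⊢nexp   : ∀ f (x y : Fin (arity S f) → V) ε →
              (List.tabulate (λ i → x i =[ ε ]ᵥ y i)
               ⊢ op f (tabulate (var ∘ x)) =[ ε ] op f (tabulate (var ∘ y))) ∈ᵖ ⟨ A ⟩
    ⊢cont   : ∀ {Γ t s ε} → (∀ ε′ → ε < ε′ → (Γ ⊢ t =[ ε′ ] s) ∈ᵖ ⟨ A ⟩) →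
              (Γ ⊢ t =[ ε ] s) ∈ᵖ ⟨ A ⟩
    ⊢subst  : ∀ {Γ φ} (σ : V → Term S V) → (Γ ⊢ φ) ∈ᵖ ⟨ A ⟩ →
              (List.map (substQEq σ) Γ ⊢ substQEq σ φ) ∈ᵖ ⟨ A ⟩
    ⊢assum  : ∀ {Γ φ} → φ ∈ Γ → (Γ ⊢ φ) ∈ᵖ ⟨ A ⟩
    ⊢cut    : ∀ {Γ Θ ψ} → (∀ {φ} → φ ∈ Θ → (Γ ⊢ φ) ∈ᵖ ⟨ A ⟩) → (Θ ⊢ ψ) ∈ᵖ ⟨ A ⟩ →
              (Γ ⊢ ψ) ∈ᵖ ⟨ A ⟩

  ⟨⟩-isTheory : ∀ A → IsTheory ⟨ A ⟩
  ⟨⟩-isTheory A = record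
    { refl = ⊢refl ; symm = ⊢symm ; triang = ⊢triang ; max = ⊢max ; nexp = ⊢nexp
    ; cont = ⊢cont ; subst = ⊢subst ; assum = ⊢assum ; cut = ⊢cut }

  ⟨⟩-least : ∀ {ℓ} {A} {𝒰 : Pred (CondQEq S) ℓ} → IsTheory 𝒰 → A ⊆ 𝒰 → ⟨ A ⟩ ⊆ 𝒰
  ⟨⟩-least {A = A} {𝒰} T A⊆𝒰 = go
    where
      module T = IsTheory T
      go : ⟨ A ⟩ ⊆ 𝒰
      go (axiom p)             = A⊆𝒰 p
      go (⊢refl x)             = T.refl x
      go (⊢symm x y ε)         = T.symm x y ε
      go (⊢triang x y z ε ε′)  = T.triang x y z ε ε′
      go (⊢max x y ε ε′ 0<ε′)  = T.max x y ε ε′ 0<ε′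
      go (⊢nexp f x y ε)       = T.nexp f x y ε
      go (⊢cont p)             = T.cont λ ε′ ε<ε′ → go (p ε′ ε<ε′)
      go (⊢subst σ p)          = T.subst σ (go p)
      go (⊢assum p)            = T.assum p
      go (⊢cut p q)            = T.cut (λ φ∈Θ → go (p φ∈Θ)) (go q)

record Theory (S : Signature) : Set₁ where
  field
    𝒰        : Pred (CondQEq S) 0ℓ
    isTheory : IsTheory 𝒰

axiomatizedBy : ∀ {S} → Pred (CondQEq S) 0ℓ → Theory S
axiomatizedBy A = record { 𝒰 = ⟨ A ⟩ ; isTheory = ⟨⟩-isTheory A }

record QAlgebra (S : Signature) (ℓ : Level) : Set (lsuc ℓ) where
  field
    space  : ExtMetric ℓ
    interp : ∀ f → NonExpansive (space ^ Fin (arity S f)) space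
  open ExtMetric space public

  mutual
    eval : ∀ {ℓ′} {X : Set ℓ′} → (X → Carrier) → Term S X → Carrier
    eval ι (var x)   = ι x
    eval ι (op f ts) = interp f $ eval* ι ts

    eval* : ∀ {ℓ′ n} {X : Set ℓ′} → (X → Carrier) → Vec (Term S X) n → Fin n → Carrier
    eval* ι (t ∷ ts) zero    = eval ι t
    eval* ι (t ∷ ts) (suc i) = eval* ι ts i

  infix 4 _⊨[_]

  _⊨[_] : QEq S → (V → Carrier) → Set ℓ
  (t =[ ε ] s) ⊨[ ι ] = d (eval ι t) (eval ι s) ≤ℚ ε

  Satisfies : CondQEq S → Set ℓ
  Satisfies (Γ ⊢ φ) = ∀ (ι : V → Carrier) → (∀ {ψ} → ψ ∈ Γ → ψ ⊨[ ι ]) → φ ⊨[ ι ]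

  eval*-lookup : ∀ {ℓ′ n} {X : Set ℓ′} (ι : X → Carrier) (ts : Vec (Term S X) n) i →
                 eval* ι ts i ≡ eval ι (lookup ts i)
  eval*-lookup ι (t ∷ ts) zero    = ≡.refl
  eval*-lookup ι (t ∷ ts) (suc i) = eval*-lookup ι ts i

  mutual
    eval-subst : ∀ {ℓ₁ ℓ₂} {X : Set ℓ₁} {Y : Set ℓ₂} (ι : Y → Carrier) (σ : X → Term S Y)
                 (t : Term S X) → eval ι (t [ σ ]) ≈ eval (eval ι ∘ σ) t
    eval-subst ι σ (var x)   = refl
    eval-subst ι σ (op f ts) = $-cong (interp f) (eval*-subst ι σ ts)

    eval*-subst : ∀ {ℓ₁ ℓ₂ n} {X : Set ℓ₁} {Y : Set ℓ₂} (ι : Y → Carrier) (σ : X → Term S Y)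
                  (ts : Vec (Term S X) n) i → eval* ι (ts [ σ ]*) i ≈ eval* (eval ι ∘ σ) ts i
    eval*-subst ι σ (t ∷ ts) zero    = eval-subst ι σ t
    eval*-subst ι σ (t ∷ ts) (suc i) = eval*-subst ι σ ts i

record Homomorphism {S ℓ} (A B : QAlgebra S ℓ) : Set ℓ where
  private
    module A = QAlgebra A
    module B = QAlgebra B
  field
    fun : NonExpansive A.space B.space
    hom : ∀ f xs → fun $ (A.interp f $ xs) B.≈ B.interp f $ (λ i → fun $ xs i)
open Homomorphism public

idₕ : ∀ {S ℓ} {A : QAlgebra S ℓ} → Homomorphism A A
idₕ {ℓ = ℓ} {A} = record { fun = Category.idn (Met ℓ) ; hom = λ _ _ → QAlgebra.refl A }

infixr 9 _∘ₕ_
_∘ₕ_ : ∀ {S ℓ} {A B C : QAlgebra S ℓ} → Homomorphism B C → Homomorphism A B → Homomorphism A C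
_∘ₕ_ {ℓ = ℓ} {C = C} g f = record
  { fun = Category._∙_ (Met ℓ) (fun g) (fun f)
  ; hom = λ o xs → QAlgebra.trans C ($-cong (fun g) (hom f o xs)) (hom g o _) }

module _ {S : Signature} (𝕌 : Theory S) where
  open Theory 𝕌

  record Model (ℓ : Level) : Set (lsuc ℓ) where
    field
      algebra : QAlgebra S ℓ
    open QAlgebra algebra public
    field
      satisfies : ∀ {φ} → φ ∈ᵖ 𝒰 → Satisfies φ

  𝕂 : ∀ ℓ → Category (lsuc ℓ) ℓ ℓ
  𝕂 ℓ = record
    { Obj       = Model ℓ
    ; Hom       = λ A B → Homomorphism (Model.algebra A) (Model.algebra B)
    ; _≈_       = λ f g → fun f M.≈ fun g
    ; idn       = idₕ
    ; _∙_       = _∘ₕ_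
    ; equiv     = record { refl  = λ {f} → M.Eq.refl {x = fun f}
                         ; sym   = λ {f} {g} → M.Eq.sym {x = fun f} {fun g}
                         ; trans = λ {f} {g} {h} → M.Eq.trans {i = fun f} {fun g} {fun h} }
    ; ∙-resp-≈  = λ {_} {_} {_} {f} {g} {h} {k} →
                  M.∙-resp-≈ {f = fun f} {fun g} {fun h} {fun k}
    ; identityˡ = λ {_} {B} _ → Model.refl B
    ; identityʳ = λ {_} {B} _ → Model.refl B
    ; assoc     = λ {_} {_} {_} {D} _ → Model.refl D
    }
    where module M = Category (Met ℓ)

  forget : ∀ ℓ → Functor (𝕂 ℓ) (Met ℓ)
  forget ℓ = record
    { F₀           = Model.space
    ; F₁           = fun
    ; F-resp-≈     = id
    ; identity     = λ {A} _ → Model.refl A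
    ; homomorphism = λ {_} {_} {B} _ → Model.refl B
    }

  -- The left adjoint of the forgetful functor sends X to the terms over the
  -- points of X, with the greatest distance for which they form a model and
  -- var is non-expansive (equivalently, t ~[ ε ] s is the least relation
  -- below); terms at distance 0 are identified.

  module _ {ℓ} (X : ExtMetric ℓ) where
    private module X = ExtMetric X

    infix 4 _~[_]_
    data _~[_]_ : Term S ∣ X ∣ → ℚ≥0 → Term S ∣ X ∣ → Set ℓ where
      ~gen   : ∀ {x y ε} → X.d x y ≤ℚ ε → var x ~[ ε ] var y
      ~refl  : ∀ {t} → t ~[ 0₊ ] t
      ~symm  : ∀ {t s ε} → t ~[ ε ] s → s ~[ ε ] t
      ~trans : ∀ {t s r ε δ} → t ~[ ε ] s → s ~[ δ ] r → t ~[ ε + δ ] r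
      ~mono  : ∀ {t s ε ε′} → ε ≤ ε′ → t ~[ ε ] s → t ~[ ε′ ] s
      ~cont  : ∀ {t s ε} → (∀ {ε′} → ε < ε′ → t ~[ ε′ ] s) → t ~[ ε ] s
      ~cong  : ∀ {f ts ss ε} → (∀ i → lookup ts i ~[ ε ] lookup ss i) →
               op f ts ~[ ε ] op f ss
      ~model : ∀ {Γ t s ε} → (Γ ⊢ t =[ ε ] s) ∈ᵖ 𝒰 → (σ : V → Term S ∣ X ∣) →
               (∀ {t′ s′ ε′} → (t′ =[ ε′ ] s′) ∈ Γ → t′ [ σ ] ~[ ε′ ] s′ [ σ ]) →
               t [ σ ] ~[ ε ] s [ σ ]

    distance : Term S ∣ X ∣ → Term S ∣ X ∣ → [0,∞] ℓ
    distance t s = record { _≤ℚ_ = λ ε → t ~[ ε ] s ; upward = ~mono ; closed = ~cont }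

    freeSpace : ExtMetric ℓ
    freeSpace = record
      { setoid = record
        { Carrier = Term S ∣ X ∣
        ; _≈_     = λ t s → t ~[ 0₊ ] s
        ; isEquivalence = record { refl = ~refl ; sym = ~symm ; trans = ~trans }
        }
      ; d      = distance
      ; d-zero = λ t s → mk⇔ (λ p → proj₁ p {0₊} ⊤ₚ.tt) (≃0∞ (distance t s))
      ; d-sym  = λ t s → ~symm , ~symm
      ; d-tri  = λ t s r p → ~cont λ {ε′} ε<ε′ →
                 let δ₁ , δ₂ , p₁ , p₂ , le = p {ε′} ε<ε′ in ~mono le (~trans p₁ p₂)
      }

    freeAlgebra : QAlgebra S ℓ
    freeAlgebra = record
      { space  = freeSpace
      ; interp = λ f → record
        { _$_     = λ ts → op f (tabulate ts)
        ; non-exp = λ ts ss p → ~cong λ i →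
                    ≡.subst₂ (λ t s → t ~[ _ ] s) (≡.sym (lookup∘tabulate ts i))
                             (≡.sym (lookup∘tabulate ss i)) (p i)
        }
      }

    private
      module Free = QAlgebra freeAlgebra

      mutual
        eval-free : ∀ (σ : V → Term S ∣ X ∣) t → Free.eval σ t ≡ t [ σ ]
        eval-free σ (var x)   = ≡.refl
        eval-free σ (op f ts) = ≡.cong (op f) (eval-free* σ ts)

        eval-free* : ∀ {n} (σ : V → Term S ∣ X ∣) (ts : Vec (Term S V) n) →
                     tabulate (Free.eval* σ ts) ≡ ts [ σ ]*
        eval-free* σ []       = ≡.refl
        eval-free* σ (t ∷ ts) = ≡.cong₂ _∷_ (eval-free σ t) (eval-free* σ ts)

      free-satisfies : ∀ φ → φ ∈ᵖ 𝒰 → Free.Satisfies φ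
      free-satisfies (Γ ⊢ t =[ ε ] s) φ∈𝒰 σ prem =
        ≡.subst₂ (_~[ ε ]_) (≡.sym (eval-free σ t)) (≡.sym (eval-free σ s))
          (~model φ∈𝒰 σ λ {t′} {s′} {ε′} ψ∈Γ →
            ≡.subst₂ (_~[ ε′ ]_) (eval-free σ t′) (eval-free σ s′) (prem ψ∈Γ))

    freeModel : Model ℓ
    freeModel = record { algebra = freeAlgebra ; satisfies = free-satisfies _ }

    generators : NonExpansive X freeSpace
    generators = record { _$_ = var ; non-exp = λ _ _ → ~gen }

    module _ (A : Model ℓ) where
      private module A = Model A

      extend : NonExpansive X A.space → Homomorphism freeAlgebra A.algebra
      extend h = record
        { fun = record { _$_ = A.eval (h $_) ; non-exp = λ _ _ → bound }
        ; hom = λ f ts → $-cong (A.interp f) λ i → A.reflexive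
            (≡.trans (A.eval*-lookup (h $_) (tabulate ts) i)
                     (≡.cong (A.eval (h $_)) (lookup∘tabulate ts i)))
        }
        where
          bound : ∀ {t s ε} → t ~[ ε ] s → A.d (A.eval (h $_) t) (A.eval (h $_) s) ≤ℚ ε
          bound (~gen p)      = non-exp h _ _ p
          bound ~refl         = A.near A.refl 0₊
          bound (~symm p)     = proj₁ (A.d-sym _ _) (bound p)
          bound (~trans p q)  = A.d-tri-≤ (bound p) (bound q)
          bound (~mono le p)  = upward (A.d _ _) le (bound p)
          bound (~cont p)     = closed (A.d _ _) λ ε<ε′ → bound (p ε<ε′)
          bound (~cong {f} {ts} {ss} p) = non-exp (A.interp f) _ _ λ i →
            ≡.subst₂ (λ a b → A.d a b ≤ℚ _)
              (≡.sym (A.eval*-lookup (h $_) ts i)) (≡.sym (A.eval*-lookup (h $_) ss i))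
              (bound (p i))
          bound (~model {t = t} {s} φ∈𝒰 σ prem) =
            A.d-resp-≈ (A.sym (A.eval-subst (h $_) σ t)) (A.sym (A.eval-subst (h $_) σ s))
              (A.satisfies φ∈𝒰 (A.eval (h $_) ∘ σ) λ {ψ} ψ∈Γ →
                A.d-resp-≈ (A.eval-subst (h $_) σ (QEq.lhs ψ)) (A.eval-subst (h $_) σ (QEq.rhs ψ))
                  (bound (prem ψ∈Γ)))

      extend-unique : (g k : Homomorphism freeAlgebra A.algebra) →
                      (∀ x → fun g $ var x A.≈ fun k $ var x) →
                      ∀ t → fun g $ t A.≈ fun k $ t
      extend-unique g k p = go
        where
          decompose : (h : Homomorphism freeAlgebra A.algebra) → ∀ f ts →
                      fun h $ op f ts A.≈ A.interp f $ (λ i → fun h $ lookup ts i)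
          decompose h f ts = ≡.subst (λ us → fun h $ op f us A.≈ A.interp f $ (λ i → fun h $ lookup ts i)) (tabulate∘lookup ts)
                               (hom h f (lookup ts))

          mutual
            go : ∀ t → fun g $ t A.≈ fun k $ t
            go (var x)   = p x
            go (op f ts) = A.trans (decompose g f ts)
              (A.trans ($-cong (A.interp f) (go* ts)) (A.sym (decompose k f ts)))

            go* : ∀ {n} (ts : Vec (Term S ∣ X ∣) n) i →
                  fun g $ lookup ts i A.≈ fun k $ lookup ts i
            go* (t ∷ ts) zero    = go t
            go* (t ∷ ts) (suc i) = go* ts i

  module _ (ℓ : Level) where
    private
      module M = Category (Met ℓ)

      mapFree : ∀ {X Y} → NonExpansive X Y → Homomorphism (freeAlgebra X) (freeAlgebra Y)
      mapFree {X} {Y} h = extend X (freeModel Y) (generators Y M.∙ h)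

      evaluate : ∀ A → Homomorphism (freeAlgebra (Model.space A)) (Model.algebra A)
      evaluate A = extend (Model.space A) A M.idn

    free : Functor (Met ℓ) (𝕂 ℓ)
    free = record
      { F₀           = freeModel
      ; F₁           = mapFree
      ; F-resp-≈     = λ {X} {Y} {f} {g} f≈g →
          extend-unique X (freeModel Y) (mapFree f) (mapFree g)
            λ x → $-cong (generators Y) (f≈g x)
      ; identity     = λ {X} →
          extend-unique X (freeModel X) (mapFree M.idn) idₕ λ _ → ~refl
      ; homomorphism = λ {X} {Y} {Z} {f} {g} →
          extend-unique X (freeModel Z) (mapFree (f M.∙ g)) (mapFree f ∘ₕ mapFree g)
            λ _ → ~refl
      }

    free⊣forget : Adjunction free (forget ℓ)
    free⊣forget = record
      { unit   = record { component = generators ; commute = λ _ _ → ~refl }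
      ; counit = record
        { component = evaluate
        ; commute   = λ {A} {B} f → extend-unique (Model.space A) B
            (evaluate B ∘ₕ mapFree (fun f)) (f ∘ₕ evaluate A) λ _ → Model.refl B
        }
      ; zig    = λ {X} → extend-unique X (freeModel X)
                   (evaluate (freeModel X) ∘ₕ mapFree (generators X)) idₕ λ _ → ~refl
      ; zag    = λ {A} _ → Model.refl A
      }

    T : Monad (Met ℓ)
    T = inducedMonad free⊣forget

readerSignature : ℕ → Signature
readerSignature n = record { Op = ⊤ ; arity = λ _ → n }

module _ {n : ℕ} where

  r : ∀ {ℓ} {X : Set ℓ} → (Fin n → Term (readerSignature n) X) → Term (readerSignature n) X
  r ts = op tt (tabulate ts)

  data ReaderAxiom : Pred (CondQEq (readerSignature n)) 0ℓ where
    idem : ∀ (x : V) → ([] ⊢ var x =[ 0₊ ] r (λ _ → var x)) ∈ᵖ ReaderAxiom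
    diag : let x : Fin n → Fin n → Term (readerSignature n) V
               x i j = var (toℕ (combine i j))   -- n² distinct variables
           in ([] ⊢ r (λ i → x i i) =[ 0₊ ] r (λ i → r (x i))) ∈ᵖ ReaderAxiom

𝓡 : ∀ n → Theory (readerSignature n)
𝓡 n = axiomatizedBy ReaderAxiom

Reader : Set → ∀ ℓ → Monad (Met ℓ)
Reader E ℓ = record
  { F = record
    { F₀           = _^ E
    ; F₁           = λ f → record
      { _$_     = λ g → (f $_) ∘ g
      ; non-exp = λ g h p e → non-exp f (g e) (h e) (p e) }
    ; F-resp-≈     = λ f≈g h e → f≈g (h e)
    ; identity     = λ {X} _ _ → ExtMetric.refl X
    ; homomorphism = λ {_} {_} {Z} _ _ → ExtMetric.refl Z
    }
  ; η = record
    { component = λ X → record { _$_ = λ x e → x ; non-exp = λ _ _ p _ → p }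
    ; commute   = λ {_} {Y} _ _ _ → ExtMetric.refl Y
    }
  ; μ = record
    { component = λ X → record
      { _$_ = λ g e → g e e ; non-exp = λ _ _ p e → p e e }
    ; commute   = λ {_} {Y} _ _ _ → ExtMetric.refl Y
    }
  ; assoc     = λ {X} _ _ → ExtMetric.refl X
  ; identityˡ = λ {X} _ _ → ExtMetric.refl X
  ; identityʳ = λ {X} _ _ → ExtMetric.refl X
  }

{-# OPTIONS --safe #-}
module Submission where

-- X^E with the diagonal operation r(g₁,…,gₙ)(eᵢ) = gᵢ(eᵢ) is a model of 𝓡, so
-- the constant maps X → X^E extend to a homomorphism from the free model.  Its
-- inverse sends g to r(g(e₁),…,g(eₙ)): the second axiom says that this is a
-- homomorphism and the first that it sends constant maps to generators.  Most of
-- the other equations are between homomorphisms out of a free model, and so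
-- need checking on generators only.

open import Level using (Level)
open import Data.Nat.Base as ℕ using (ℕ)
open import Data.Nat.Properties using (_<?_)
open import Data.Fin.Base using (Fin; toℕ; fromℕ<; combine; remQuot)
open import Data.Fin.Properties using (toℕ<n; fromℕ<-toℕ; remQuot-combine)
open import Data.List.Membership.Propositional.Properties using (∈-map⁺; ∈-tabulate⁺)
open import Data.List.Relation.Unary.Any using (here; there)
open import Data.Product.Base using (uncurry; proj₁)
import Data.Rational.Base as ℚ
import Data.Rational.Properties as ℚₚ
open import Data.Unit.Base using (tt)
open import Data.Vec.Base using (tabulate)
open import Data.Vec.Properties using (lookup∘tabulate)
open import Function.Base using (_∘_)
open import Function.Bundles using (_↔_; Inverse)
open import Relation.Binary.PropositionalEquality as ≡ using (_≡_)
open import Relation.Nullary using (yes; no; contradiction)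
open import Defs

p≤p+q : ∀ p q → p ≤ p + q
p≤p+q p q = ≡.subst (ℚ._≤ value (p + q)) (ℚₚ.+-identityʳ (value p))
              (ℚₚ.+-monoʳ-≤ (value p) (0≤ q))

-- An assignment must give a value to every variable of `V`, but the values of interest form a
-- finite family; `a` fills the rest.
padWith : ∀ {a} {A : Set a} {m} → A → (Fin m → A) → ℕ → A
padWith {m = m} a f k with k <? m
... | yes k<m = f (fromℕ< k<m)
... | no  _   = a

padWith-toℕ : ∀ {a} {A : Set a} {m} (a : A) (f : Fin m → A) i → padWith a f (toℕ i) ≡ f i
padWith-toℕ {m = m} a f i with toℕ i <? m
... | yes i<m = ≡.cong f (fromℕ<-toℕ i i<m)
... | no  i≮m = contradiction (toℕ<n i) i≮m

module _ {S : Signature} {ℓ : Level} (A : QAlgebra S ℓ) where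
  open QAlgebra A

  eval*-tabulate : ∀ {ℓ′ m} {X : Set ℓ′} (ι : X → Carrier) (ts : Fin m → Term S X) i →
                   eval* ι (tabulate ts) i ≡ eval ι (ts i)
  eval*-tabulate ι ts i = ≡.trans (eval*-lookup ι (tabulate ts) i)
                                  (≡.cong (eval ι) (lookup∘tabulate ts i))

  -- Soundness of the deduction rules. Through `⟨⟩-least` it reduces satisfaction of a generated
  -- theory to satisfaction of its axioms.
  Satisfies-isTheory : IsTheory Satisfies
  Satisfies-isTheory = record
    { refl   = λ _ _ _ → near refl 0₊
    ; symm   = λ _ _ _ _ prem → proj₁ (d-sym _ _) (prem (here ≡.refl))
    ; triang = λ _ _ _ _ _ _ prem →
               d-tri-≤ (prem (here ≡.refl)) (prem (there (here ≡.refl)))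
    ; max    = λ x y ε ε′ _ ι prem → upward (d (ι x) (ι y)) (p≤p+q ε ε′) (prem (here ≡.refl))
    ; nexp   = λ f x y ε ι prem → non-exp (interp f) _ _ λ i →
               ≡.subst₂ (λ a b → d a b ≤ℚ ε)
                 (≡.sym (eval*-tabulate ι (var ∘ x) i)) (≡.sym (eval*-tabulate ι (var ∘ y) i))
                 (prem (∈-tabulate⁺ i))
    ; cont   = λ p ι prem → closed (d _ _) λ {ε′} ε<ε′ → p ε′ ε<ε′ ι prem
    ; subst  = λ {_} {φ} σ p ι prem →
               d-resp-≈ (sym (eval-subst ι σ (QEq.lhs φ))) (sym (eval-subst ι σ (QEq.rhs φ)))
                 (p (eval ι ∘ σ) λ {ψ} ψ∈Γ →
                   d-resp-≈ (eval-subst ι σ (QEq.lhs ψ)) (eval-subst ι σ (QEq.rhs ψ))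
                     (prem (∈-map⁺ (substQEq σ) ψ∈Γ)))
    ; assum  = λ φ∈Γ _ prem → prem φ∈Γ
    ; cut    = λ p q ι prem → q ι λ φ∈Θ → p φ∈Θ ι prem
    }

module _ {n : ℕ} {ℓ : Level} (A : QAlgebra (readerSignature n) ℓ) where
  open QAlgebra A

  eval-r : ∀ {ℓ′} {X : Set ℓ′} (ι : X → Carrier) (ts : Fin n → Term (readerSignature n) X) →
           eval ι (r ts) ≈ interp tt $ (λ i → eval ι (ts i))
  eval-r ι ts = $-cong (interp tt) λ i → reflexive (eval*-tabulate A ι ts i)

  -- The hypotheses are the axioms restated for the operation itself, so a concrete algebra need not
  -- handle terms or assignments.
  reader-satisfies : (∀ x → x ≈ interp tt $ (λ _ → x)) →
                     (∀ (x : Fin n → Fin n → Carrier) →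
                       interp tt $ (λ i → x i i) ≈ interp tt $ (λ i → interp tt $ x i)) →
                     ∀ {φ} → Theory.𝒰 (𝓡 n) φ → Satisfies φ
  reader-satisfies idempotent diagonal = ⟨⟩-least (Satisfies-isTheory A) λ where
    (idem x) ι _ → near (trans (idempotent (ι x)) (sym (eval-r ι (λ _ → var x)))) 0₊
    diag     ι _ → near
      (trans (eval-r ι _)
        (trans (diagonal λ i j → ι (toℕ (combine i j)))
          (sym (trans (eval-r ι _)
            ($-cong (interp tt) λ i → eval-r ι (λ j → var (toℕ (combine i j)))))))) 0₊

module _ {n : ℕ} {ℓ : Level} (A : Model (𝓡 n) ℓ) where
  open Model A

  idempotent : ∀ x → x ≈ interp tt $ (λ _ → x)
  idempotent x = trans (near⁻¹ (satisfies (axiom (idem 0)) (λ _ → x) λ ()))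
                       (eval-r algebra (λ _ → x) (λ _ → var 0))

  -- The variables in the axiom are pairwise distinct, so a single assignment can realise an
  -- arbitrary square array.
  diagonal : ∀ (x : Fin n → Fin n → Carrier) →
             interp tt $ (λ i → x i i) ≈ interp tt $ (λ i → interp tt $ x i)
  diagonal x =
    trans ($-cong (interp tt) λ i → sym (ι-combine i i))
      (trans (sym (eval-r algebra ι _))
        (trans (near⁻¹ (satisfies (axiom diag) ι λ ()))
          (trans (eval-r algebra ι _)
            ($-cong (interp tt) λ i →
              trans (eval-r algebra ι (λ j → var (toℕ (combine i j))))
                    ($-cong (interp tt) (ι-combine i))))))
    where
      -- `remQuot n` decodes the variable number `combine i j` into row and column.
      entry : Fin (n ℕ.* n) → Carrier
      entry = uncurry x ∘ remQuot n

      -- This value past n² also exists when n = 0, where x has no entries.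
      ι : V → Carrier
      ι = padWith (interp tt $ (λ i → x i i)) entry

      ι-combine : ∀ i j → ι (toℕ (combine i j)) ≈ x i j
      ι-combine i j = reflexive (≡.trans (padWith-toℕ _ entry (combine i j))
                                         (≡.cong (uncurry x) (remQuot-combine i j)))

module FinitePower (ℓ : Level) {n : ℕ} {E : Set} (Fin↔E : Fin n ↔ E) where
  private
    module Rd = Monad (Reader E ℓ)

    enum : Fin n → E
    enum = Inverse.to Fin↔E

    index : E → Fin n
    index = Inverse.from Fin↔E

    enum-index : ∀ e → enum (index e) ≡ e
    enum-index e = Inverse.inverseˡ Fin↔E ≡.refl

    index-enum : ∀ i → index (enum i) ≡ i
    index-enum i = Inverse.inverseʳ Fin↔E ≡.refl

  powerAlgebra : ExtMetric ℓ → QAlgebra (readerSignature n) ℓ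
  powerAlgebra X = record
    { space  = X ^ E
    ; interp = λ _ → record
      { _$_     = λ gs e → gs (index e) e
      ; non-exp = λ _ _ p e → p (index e) e }
    }

  powerModel : ExtMetric ℓ → Model (𝓡 n) ℓ
  powerModel X = record
    { algebra   = powerAlgebra X
    ; satisfies = reader-satisfies (powerAlgebra X)
        -- At `e`, both sides of the diagonal law compute to the entry in row and column `index e`,
        -- evaluated at `e`.
        (λ _ _ → ExtMetric.refl X) (λ _ _ → ExtMetric.refl X)
    }

  -- With `joinPower`, this makes the naturality and multiplication squares equations between
  -- homomorphisms, within reach of `extend-unique`.
  mapPower : ∀ {X Y} → NonExpansive X Y → Homomorphism (powerAlgebra X) (powerAlgebra Y)
  mapPower {Y = Y} f = record { fun = Rd.F.F₁ f ; hom = λ _ _ _ → ExtMetric.refl Y }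

  joinPower : ∀ X → Homomorphism (powerAlgebra (X ^ E)) (powerAlgebra X)
  joinPower X = record { fun = Rd.μ.component X ; hom = λ _ _ _ → ExtMetric.refl X }

  module _ (X : ExtMetric ℓ) where
    private
      module X = ExtMetric X
      module F = Model (freeModel (𝓡 n) X)

    run : Homomorphism (freeAlgebra (𝓡 n) X) (powerAlgebra X)
    run = extend (𝓡 n) X (powerModel X) (Rd.η.component X)

    table : Homomorphism (powerAlgebra X) (freeAlgebra (𝓡 n) X)
    table = record
      { fun = record
        { _$_     = λ g → r (λ i → var (g (enum i)))
        ; non-exp = λ g h p → non-exp (F.interp tt) _ _ λ i → ~gen (p (enum i)) }
      -- One side is `r` of the diagonal of the array `var (gs i (enum j))`, once `index (enum i)`
      -- is rewritten to `i`; the other is `r` of the `r` of its rows.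
      ; hom = λ _ gs → F.trans
          ($-cong (F.interp tt) λ i → F.reflexive
            (≡.cong (λ j → var (gs j (enum i))) (index-enum i)))
          (diagonal (freeModel (𝓡 n) X) λ i j → var (gs i (enum j)))
      }

    -- The source is not free, so this is computed directly: `run` turns the table into the diagonal
    -- of the constant maps at `g (enum i)`, and at `e` the index `index e` is selected.
    run∘table : ∀ g e → (fun run $ (fun table $ g)) e X.≈ g e
    run∘table g e = X.trans (hom run tt (λ i → var (g (enum i))) e)
                            (X.reflexive (≡.cong g (enum-index e)))

    table∘run : ∀ t → fun table $ (fun run $ t) F.≈ t
    table∘run = extend-unique (𝓡 n) X (freeModel (𝓡 n) X) (table ∘ₕ run) idₕ
      λ x → F.sym (idempotent (freeModel (𝓡 n) X) (var x))

theorem4p8 : ∀ (ℓ : Level) (n : ℕ) (E : Set) → Fin n ↔ E →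
    MonadIso (T (𝓡 n) ℓ) (Reader E ℓ)
theorem4p8 ℓ n E Fin↔E = record
  { to        = record
    { component = λ X → fun (run X)
    ; commute   = λ {X} {Y} f → extend-unique (𝓡 n) X (powerModel Y)
        (run Y ∘ₕ Free.F₁ f) (mapPower f ∘ₕ run X)
        λ _ _ → ExtMetric.refl Y
    }
  ; from      = record
    { component = λ X → fun (table X)
    -- A table is `r` of generators, and `Free.F₁ f` preserves `r` and acts as `f` on generators.
    ; commute   = λ {_} {Y} f _ → Model.sym (Free.F₀ Y) (hom (Free.F₁ f) tt _)
    }
  ; to∘from   = run∘table
  ; from∘to   = table∘run
  ; unit-comm = λ X _ _ → ExtMetric.refl X
  -- The generators are now terms `t` over `X`; both composites send `var t` to `fun (run X) $ t`.
  ; mult-comm = λ X → extend-unique (𝓡 n) (T𝓡.F.F₀ X) (powerModel X)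
      (run X ∘ₕ counit (Free.F₀ X))
      (joinPower X ∘ₕ (mapPower (fun (run X)) ∘ₕ run (T𝓡.F.F₀ X)))
      λ _ _ → ExtMetric.refl X
  }
  where
    module Free = Functor (free (𝓡 n) ℓ)
    module T𝓡 = Monad (T (𝓡 n) ℓ)
    counit = Adjunction.counit.component (free⊣forget (𝓡 n) ℓ)
    open FinitePower ℓ Fin↔E
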